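{- Let $T$ be a trajectory string over the alphabet $\Sigma$, let $T_{bwt}$ be its Burrows--Wheeler transform, let $\phi$ be any relative movement labeling (RML) function for $T$, and let $\phi(T_{bwt})$ be the labeled BWT. Let $w,w'\in\Sigma$ and let $j$ be an integer. If $w\in N_{out}(w')$ and $C[w']\le j\le C[w'+1]$, then $$\mathrm{rank}_w(T_{bwt},j)=\mathrm{rank}_{\eta}(\phi(T_{bwt}),j)-Z_{w'w},$$ where $\eta:=\phi(w|w')$ and $$Z_{w'w}:=\mathrm{rank}_{\eta}(\phi(T_{bwt}),C[w'])-\mathrm{rank}_w(T_{bwt},C[w']).$$
   Context: Strings have 0-based subscripts; $S[i,j)$ denotes the substring from position $i$ to $j-1$, and $\mathrm{rank}_x(S,j)$ is the number of occurrences of the symbol $x$ in $S[0,j)$. Trajectory string: a network-constrained trajectory (NCT) on a directed graph $(V,E)$ is a (nonempty) sequence $e_1e_2\cdots e_n$ of physically connected road segments $e_i\in E$ (the end vertex of $e_i$ is the start vertex of $e_{i+1}$). Given NCTs $T_1,\dots,T_N$, the trajectory string is $T=T_1^r\,\$\,T_2^r\,\$\cdots T_N^r\,\$\,\#$, where $T_k^r$ is the reversal of $T_k$ and $\$,\#$ are special symbols not in $E$. The alphabet is $\Sigma=E\cup\{\$,\#\}$, $\sigma=|\Sigma|$, totally ordered with $\#<\$<w$ for all $w\in E$ (any total order on $E$). BWT: $T_{bwt}$ is the last column of the list of all $|T|$ cyclic rotations of $T$ sorted lexicographically. $C[w]$ is the number of symbols (with multiplicity) in $T$ that are strictly smaller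 than $w$; $w+1$ denotes the successor of $w$ in $\Sigma$, so $C[w+1]$ is the number of symbols of $T$ that are $\le w$ (equal to $|T|$ if $w$ is the largest symbol). Thus the sorted rotations starting with $w$ are exactly those at positions in $[C[w],C[w+1])$. ET-graph: the directed graph $G_T$ with vertex set $\Sigma$ and edge set $E_T$, where $(w',w)\in E_T$ iff $ww'$ occurs as a substring of $T$, with $T$ read cyclically. $N_{out}(w')=\{w:(w',w)\in E_T\}$. RML function: an assignment of labels $\phi(w|w')\in\{1,\dots,\sigma\}$ for each $w'\in\Sigma$ and $w\in N_{out}(w')$, such that for each $w'$ the map $\phi(\cdot|w')$ is one-to-one on $N_{out}(w')$. Labeled BWT: $\phi(T_{bwt})$ is the string of length $|T|$ whose $i$-th symbol is $\phi(T_{bwt}[i]\,|\,w')$, where $w'$ is the unique symbol with $C[w']\le i<C[w'+1]$. -}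

module Defs where

open import Data.Fin.Base using (Fin; zero; suc; toℕ; fromℕ<)
open import Data.Fin.Properties using (toℕ<n; toℕ-fromℕ<)
open import Data.List.Base
  using (List; []; _∷_; _++_; length; map; concatMap; reverse; filter; take; drop;
         upTo; last; mapMaybe; lookup; tabulate)
open import Data.List.NonEmpty.Base using (List⁺; toList)
open import Data.List.Properties
  using (length-map; length-upTo; length-++-comm; take++drop≡id;
         filter-accept; filter-none)
open import Data.List.Membership.Propositional.Properties using (∈-lookup)
open import Data.List.Relation.Binary.Infix.Heterogeneous using (Infix)
import Data.List.Relation.Binary.Lex.Strict as Lex
open import Data.List.Relation.Binary.Permutation.Propositional using (_↭_; ↭-sym)
open import Data.List.Relation.Binary.Permutation.Propositional.Properties
  using (↭-length; filter-↭; All-resp-↭)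
open import Data.List.Relation.Unary.All as All using (All; []; _∷_)
import Data.List.Relation.Unary.All.Properties as Allₚ
open import Data.List.Relation.Unary.AllPairs using (AllPairs; []; _∷_)
open import Data.List.Relation.Unary.Any using (Any)
open import Data.List.Relation.Unary.Linked using (Linked)
open import Data.List.Relation.Unary.Sorted.TotalOrder.Properties using (Sorted⇒AllPairs)
import Data.List.Sort as Sort
open import Data.Maybe.Base using (just; nothing)
open import Data.Nat.Base using (ℕ; zero; suc; _+_; z≤n; s≤s)
import Data.Nat.Base as ℕ
import Data.Nat.Properties as ℕ
open import Data.Product.Base using (∃; _×_; _,_; proj₁; proj₂)
open import Data.Product using (∃!)
open import Data.Sum.Base using (inj₁; inj₂)
open import Function.Bundles using (_↔_)
open import Level using (0ℓ)
open import Relation.Binary.Bundles using (StrictTotalOrder)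
open import Relation.Binary.Core using (Rel)
open import Relation.Binary.Construct.Add.Infimum.Strict using (_<₋_; <₋-isStrictTotalOrder-≡)
open import Relation.Binary.Definitions using (DecidableEquality; tri<; tri≈; tri>)
import Relation.Binary.Properties.StrictTotalOrder as NonStrict
open import Relation.Binary.PropositionalEquality
  using (_≡_; refl; sym; trans; cong; subst)
open import Relation.Binary.Structures using (IsStrictTotalOrder)
open import Relation.Nullary using (¬_; yes; no; contradiction)
open import Relation.Nullary.Construct.Add.Infimum using (_₋; ⊥₋; [_])
open import Relation.Unary using (Pred; Decidable; _∈_)

count : ∀ {a p} {A : Set a} {P : Pred A p} → Decidable P → List A → ℕ
count P? xs = length (filter P? xs)

rank : ∀ {a} {A : Set a} → DecidableEquality A → A → List A → ℕ → ℕ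
rank _≟_ x S j = count (x ≟_) (take j S)

rotate : ∀ {a} {A : Set a} → ℕ → List A → List A
rotate i xs = drop i xs ++ take i xs

rotations : ∀ {a} {A : Set a} → List A → List (List A)
rotations xs = map (λ i → rotate i xs) (upTo (length xs))

length-rotate : ∀ {a} {A : Set a} i (xs : List A) → length (rotate i xs) ≡ length xs
length-rotate i xs = trans (length-++-comm (drop i xs) (take i xs))
                           (cong length (take++drop≡id i xs))

length-mapMaybe-last : ∀ {a} {A : Set a} {xss : List (List A)} →
  All (λ xs → 0 ℕ.< length xs) xss → length (mapMaybe last xss) ≡ length xss
length-mapMaybe-last [] = refl
length-mapMaybe-last (_∷_ {x = xs} p ps) with last xs | last-just xs p
  where
  last-just : ∀ {a} {A : Set a} (xs : List A) → 0 ℕ.< length xs → ∃ λ x → last xs ≡ just x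
  last-just (x ∷ [])     _ = x , refl
  last-just (_ ∷ y ∷ xs) _ = last-just (y ∷ xs) (s≤s z≤n)
... | just _ | _ = cong suc (length-mapMaybe-last ps)

count-accept : ∀ {a p} {A : Set a} {P : Pred A p} (P? : Decidable P) {x} xs →
  P x → count P? (x ∷ xs) ≡ suc (count P? xs)
count-accept P? xs px = cong length (filter-accept P? px)

count-∷-≤ : ∀ {a p} {A : Set a} {P : Pred A p} (P? : Decidable P) x xs →
  count P? (x ∷ xs) ℕ.≤ suc (count P? xs)
count-∷-≤ P? x xs with P? x
... | yes _ = ℕ.≤-refl
... | no  _ = ℕ.n≤1+n _

count-mono : ∀ {a p q} {A : Set a} {P : Pred A p} {Q : Pred A q}
  (P? : Decidable P) (Q? : Decidable Q) → (∀ {x} → P x → Q x) →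
  ∀ xs → count P? xs ℕ.≤ count Q? xs
count-mono P? Q? P⇒Q [] = z≤n
count-mono P? Q? P⇒Q (x ∷ xs) with P? x | Q? x
... | yes _  | yes _  = s≤s (count-mono P? Q? P⇒Q xs)
... | yes px | no ¬qx = contradiction (P⇒Q px) ¬qx
... | no _   | yes _  = ℕ.m≤n⇒m≤1+n (count-mono P? Q? P⇒Q xs)
... | no _   | no _   = count-mono P? Q? P⇒Q xs

module Counting (O : StrictTotalOrder 0ℓ 0ℓ 0ℓ) where
  open StrictTotalOrder O public
    using (_≈_; _<_; _<?_; compare; irrefl) renaming (Carrier to A; trans to <-trans)
  open NonStrict O public using (_≤_; _≤?_; decTotalOrder)
  open NonStrict O using (totalOrder) renaming (trans to ≤-trans)
  open StrictTotalOrder O using (<-respˡ-≈; <-respʳ-≈; module Eq)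

  ≤⇒≯ : ∀ {x y} → x ≤ y → ¬ (y < x)
  ≤⇒≯ (inj₁ x<y) y<x = irrefl Eq.refl (<-trans x<y y<x)
  ≤⇒≯ (inj₂ x≈y) y<x = irrefl (Eq.sym x≈y) y<x

  C : List A → A → ℕ
  C S w = count (_<? w) S

  -- C[w + 1], as the number of symbols that are at most w.
  C⁺ : List A → A → ℕ
  C⁺ S w = count (_≤? w) S

  InBlock : List A → ℕ → A → Set
  InBlock S i w = C S w ℕ.≤ i × i ℕ.< C⁺ S w

  sorted-inBlock : ∀ {S} → AllPairs _≤_ S → (i : Fin (length S)) →
    InBlock S (toℕ i) (lookup S i)
  sorted-inBlock {x ∷ S} (x≤S ∷ _) zero =
    ℕ.≤-reflexive (cong length (filter-none (_<? x) (irrefl Eq.refl ∷ All.map ≤⇒≯ x≤S))) ,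
    subst (0 ℕ.<_) (sym (count-accept (_≤? x) S (inj₂ Eq.refl))) (s≤s z≤n)
  sorted-inBlock {x ∷ S} (x≤S ∷ S↗) (suc i) with sorted-inBlock S↗ i
  ... | C≤i , i<C⁺ =
    ℕ.≤-trans (count-∷-≤ (_<? lookup S i) x S) (s≤s C≤i) ,
    subst (suc (toℕ i) ℕ.<_)
      (sym (count-accept (_≤? lookup S i) S (All.lookup x≤S (∈-lookup i)))) (s≤s i<C⁺)

  inBlock-↭ : ∀ {S S′ i w} → S ↭ S′ → InBlock S i w → InBlock S′ i w
  inBlock-↭ {i = i} {w} p (l , u) =
    subst (ℕ._≤ i) (↭-length (filter-↭ (_<? w) p)) l ,
    subst (i ℕ.<_) (↭-length (filter-↭ (_≤? w) p)) u

  C⁺≤C : ∀ S {v w} → v < w → C⁺ S v ℕ.≤ C S w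
  C⁺≤C S {v} {w} v<w = count-mono (_≤? v) (_<? w) below S
    where
    below : ∀ {x} → x ≤ v → x < w
    below (inj₁ x<v) = <-trans x<v v<w
    below (inj₂ x≈v) = <-respˡ-≈ (Eq.sym x≈v) v<w

  inBlock-unique : ∀ S {i v w} → InBlock S i v → InBlock S i w → v ≈ w
  inBlock-unique S {v = v} {w} (l , u) (l′ , u′) with compare v w
  ... | tri< v<w _ _ = contradiction (ℕ.≤-trans u (ℕ.≤-trans (C⁺≤C S v<w) l′)) (ℕ.<-irrefl refl)
  ... | tri≈ _ v≈w _ = v≈w
  ... | tri> _ _ w<v = contradiction (ℕ.≤-trans u′ (ℕ.≤-trans (C⁺≤C S w<v) l)) (ℕ.<-irrefl refl)

  block : ∀ S {i} → i ℕ.< length S → ∃! _≈_ (InBlock S i)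
  block S {i} i<n = _ , found , inBlock-unique S found
    where
    open Sort decTotalOrder
    i<n′  = subst (i ℕ.<_) (sym (↭-length (sort-↭ S))) i<n
    found = inBlock-↭ (sort-↭ S)
      (subst (λ k → InBlock (sort S) k (lookup (sort S) (fromℕ< i<n′))) (toℕ-fromℕ< i<n′)
        (sorted-inBlock (Sorted⇒AllPairs totalOrder (sort-↗ S)) (fromℕ< i<n′)))

record RoadNetwork : Set₁ where
  infix 4 _<ᴱ_
  field
    V                  : Set
    E                  : Set
    start end          : E → V
    ∣E∣                : ℕ
    finite             : E ↔ Fin ∣E∣
    _<ᴱ_               : Rel E 0ℓ
    isStrictTotalOrder : IsStrictTotalOrder _≡_ _<ᴱ_

record NCT (G : RoadNetwork) : Set where
  open RoadNetwork G
  field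
    segments  : List⁺ E
    connected : Linked (λ e f → end e ≡ start f) (toList segments)

-- Σ is E with two new least elements adjoined, so that # < $ < seg e.
pattern #     = ⊥₋
pattern $     = [ ⊥₋ ]
pattern seg e = [ [ e ] ]

module Trajectories (G : RoadNetwork) (Ts : List⁺ (NCT G)) where
  open RoadNetwork G

  Symbol : Set
  Symbol = (E ₋) ₋

  σ : ℕ
  σ = 2 + ∣E∣

  symbolOrder : StrictTotalOrder 0ℓ 0ℓ 0ℓ
  symbolOrder = record
    { Carrier            = Symbol
    ; _≈_                = _≡_
    ; _<_                = _<₋_ (_<₋_ _<ᴱ_)
    ; isStrictTotalOrder = <₋-isStrictTotalOrder-≡ _ (<₋-isStrictTotalOrder-≡ _ isStrictTotalOrder)
    }

  open StrictTotalOrder symbolOrder public using (_≟_)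
  open Counting symbolOrder using (InBlock; block) renaming (C to C-of; C⁺ to C⁺-of)

  encode : NCT G → List Symbol
  encode t = map seg (reverse (toList (NCT.segments t))) ++ $ ∷ []

  T : List Symbol
  T = concatMap encode (toList Ts) ++ # ∷ []

  C C⁺ : Symbol → ℕ
  C  = C-of  T
  C⁺ = C⁺-of T

  open Sort (Lex.≤-decTotalOrder symbolOrder) using (sort; sort-↭)

  T-bwt : List Symbol
  T-bwt = mapMaybe last (sort (rotations T))

  length-T-bwt : length T-bwt ≡ length T
  length-T-bwt = trans (length-mapMaybe-last (All-resp-↭ (↭-sym (sort-↭ (rotations T))) nonempty))
    (trans (↭-length (sort-↭ (rotations T)))
    (trans (length-map _ (upTo (length T))) (length-upTo (length T))))
    where
    0<∣T∣ : 0 ℕ.< length T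
    0<∣T∣ = subst (0 ℕ.<_) (length-++-comm (# ∷ []) (concatMap encode (toList Ts))) (s≤s z≤n)

    nonempty : All (λ xs → 0 ℕ.< length xs) (rotations T)
    nonempty = Allₚ.map⁺ (All.universal (λ i → subst (0 ℕ.<_) (sym (length-rotate i T)) 0<∣T∣) _)

  ET : Rel Symbol 0ℓ
  ET w′ w = Any (Infix _≡_ (w ∷ w′ ∷ [])) (rotations T)

  N-out : Symbol → Pred Symbol 0ℓ
  N-out w′ w = ET w′ w

  -- φ w w′ is φ(w | w′); its values for w outside N-out w′ are junk.
  record RML : Set where
    field
      φ          : Symbol → Symbol → ℕ
      range      : ∀ {w′ w} → w ∈ N-out w′ → 1 ℕ.≤ φ w w′ × φ w w′ ℕ.≤ σ
      one-to-one : ∀ {w′ u v} → u ∈ N-out w′ → v ∈ N-out w′ → φ u w′ ≡ φ v w′ → u ≡ v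

  context : (i : Fin (length T-bwt)) → ∃! _≡_ (InBlock T (toℕ i))
  context i = block T (subst (toℕ i ℕ.<_) length-T-bwt (toℕ<n i))

  labeledBWT : RML → List ℕ
  labeledBWT r = tabulate (λ i → RML.φ r (lookup T-bwt i) (proj₁ (context i)))

{-# OPTIONS --safe #-}
-- On the positions C w′ ≤ i < C⁺ w′ every sorted rotation starts with w′, so its last symbol u
-- precedes w′ cyclically in T and hence lies in N-out w′. As φ(· | w′) is one-to-one there, the
-- i-th label is φ w w′ exactly when the i-th symbol of T-bwt is w: from C w′ up to j both ranks
-- grow by the same amount.
module Submission where

open import Defs
open import Data.Fin.Base as Fin using (Fin; zero; suc; toℕ; fromℕ<)
open import Data.Fin.Properties using (toℕ<n; toℕ-cast; toℕ-fromℕ<)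
import Data.Integer as ℤ
open import Data.Integer using (ℤ; +_; _-_)
open import Data.Integer.Tactic.RingSolver using (solve-∀)
open import Data.List.Base
  using (List; []; _∷_; _++_; _∷ʳ_; length; head; last; map; mapMaybe; concatMap; lookup; tabulate;
         take; drop; reverse; applyUpTo; initLast; _∷ʳ′_)
open import Data.List.Membership.Propositional using (lose) renaming (_∈_ to _∈ₗ_)
open import Data.List.Membership.Propositional.Properties using (∈-map⁺; ∈-upTo⁺)
open import Data.List.NonEmpty.Base using (List⁺; _∷_; toList)
open import Data.List.Properties
  using (++-identityʳ; ++-assoc; length-++; length-++-≤ˡ; length-++-≤ʳ; take-suc; take-all;
         drop-all; map-upTo)
open import Data.List.Relation.Binary.Infix.Heterogeneous using (Infix; here; _++ⁱ_)
open import Data.List.Relation.Binary.Lex.Strict as Lex using (this; next)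
open import Data.List.Relation.Binary.Permutation.Propositional
  using (↭-trans; ↭-reflexive; ↭-sym)
open import Data.List.Relation.Binary.Permutation.Propositional.Properties
  using (All-resp-↭; mapMaybe-↭)
open import Data.List.Relation.Binary.Pointwise as Pointwise using (Pointwise; []; _∷_)
open import Data.List.Relation.Binary.Prefix.Heterogeneous using ([]; _∷_)
open import Data.List.Relation.Unary.All as All using (All; []; _∷_)
import Data.List.Relation.Unary.All.Properties as All
open import Data.List.Relation.Unary.AllPairs using (AllPairs; []; _∷_)
open import Data.List.Relation.Unary.Any using (Any)
open import Data.List.Relation.Unary.Sorted.TotalOrder.Properties using (Sorted⇒AllPairs)
import Data.List.Sort as Sort
open import Data.Maybe.Base using (just)
import Data.Maybe.Relation.Unary.All as Maybe
open import Data.Nat using (ℕ; zero; suc; z≤n; s≤s; _+_; _≤_; _<_)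
import Data.Nat.Properties as ℕ
open import Data.Product using (∃₂; _×_; _,_; proj₁; proj₂)
open import Data.Sum using (inj₁; inj₂)
open import Function using (_⇔_; mk⇔; module Equivalence; _∘_)
open import Level using (Level; 0ℓ; _⊔_)
open import Relation.Binary.Bundles using (DecTotalOrder; StrictTotalOrder)
open import Relation.Binary.Core using (Rel)
open import Relation.Binary.Definitions using (DecidableEquality)
open import Relation.Binary.PropositionalEquality
  using (_≡_; refl; sym; trans; cong; cong₂; subst; module ≡-Reasoning)
open import Relation.Nullary using (yes; no; contradiction)
open import Relation.Unary using (_∈_)

private
  variable
    a b ℓ : Level
    A : Set a
    B : Set b

module _ (_≟₁_ : DecidableEquality A) (_≟₂_ : DecidableEquality B) {x : A} {y : B} where

  rank-cong : ∀ xs (f : Fin (length xs) → B) j →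
    (∀ i → toℕ i < j → x ≡ lookup xs i ⇔ y ≡ f i) →
    rank _≟₁_ x xs j ≡ rank _≟₂_ y (tabulate f) j
  rank-cong xs       f zero    agree = refl
  rank-cong []       f (suc j) agree = refl
  rank-cong (z ∷ xs) f (suc j) agree
    with ih ← rank-cong xs (f ∘ suc) j (λ i i<j → agree (suc i) (s≤s i<j))
    with x ≟₁ z | y ≟₂ f zero
  ... | yes _   | yes _   = cong suc ih
  ... | yes x≡z | no y≢f  = contradiction (Equivalence.to (agree zero (s≤s z≤n)) x≡z) y≢f
  ... | no x≢z  | yes y≡f = contradiction (Equivalence.from (agree zero (s≤s z≤n)) y≡f) x≢z
  ... | no _    | no _    = ih

  -- Equality of the two rank increments from k to j, with both sides moved so that no
  -- subtraction occurs.
  rank-increment-cong : ∀ xs (f : Fin (length xs) → B) {k j} → k ≤ j →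
    (∀ i → k ≤ toℕ i → toℕ i < j → x ≡ lookup xs i ⇔ y ≡ f i) →
    rank _≟₁_ x xs j + rank _≟₂_ y (tabulate f) k ≡
    rank _≟₂_ y (tabulate f) j + rank _≟₁_ x xs k
  rank-increment-cong xs f {j = j} z≤n agree =
    cong (_+ 0) (rank-cong xs f j (λ i → agree i z≤n))
  rank-increment-cong [] f (s≤s k≤j) agree = refl
  rank-increment-cong (z ∷ xs) f {suc k} {suc j} (s≤s k≤j) agree
    with ih ← rank-increment-cong xs (f ∘ suc) k≤j
                (λ i k≤i i<j → agree (suc i) (s≤s k≤i) (s≤s i<j))
    with x ≟₁ z | y ≟₂ f zero
  -- Position zero precedes the window, so the two tests are unrelated; a hit in either one adds one
  -- to both sides.
  ... | yes _   | yes _   = cong suc (trans (ℕ.+-suc _ _) (trans (cong suc ih) (sym (ℕ.+-suc _ _))))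
  ... | yes _   | no _    = trans (cong suc ih) (sym (ℕ.+-suc _ _))
  ... | no _    | yes _   = trans (ℕ.+-suc _ _) (cong suc ih)
  ... | no _    | no _    = ih

drop-lookup : (xs : List A) (i : Fin (length xs)) →
  drop (toℕ i) xs ≡ lookup xs i ∷ drop (suc (toℕ i)) xs
drop-lookup (x ∷ xs) zero    = refl
drop-lookup (x ∷ xs) (suc i) = drop-lookup xs i

rotate-length : (xs : List A) → rotate (length xs) xs ≡ rotate 0 xs
rotate-length xs = trans
  (cong₂ _++_ (drop-all (length xs) xs ℕ.≤-refl) (take-all (length xs) xs ℕ.≤-refl))
  (sym (++-identityʳ xs))

-- The bound includes `length xs`, where the rotation wraps around to `rotate 0 xs`, because
-- `rotate-ends` passes from the last index to its successor.
rotate∈rotations : ∀ {i} (xs : List A) → 0 < length xs → i ≤ length xs → rotate i xs ∈ₗ rotations xs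
rotate∈rotations xs 0<n i≤n with ℕ.m≤n⇒m<n∨m≡n i≤n
... | inj₁ i<n  = ∈-map⁺ _ (∈-upTo⁺ i<n)
... | inj₂ refl = subst (_∈ₗ rotations xs) (sym (rotate-length xs)) (∈-map⁺ _ (∈-upTo⁺ 0<n))

rotate-suc : (xs : List A) (i : Fin (length xs)) →
  let rest = drop (suc (toℕ i)) xs ++ take (toℕ i) xs in
  rotate (toℕ i) xs ≡ lookup xs i ∷ rest × rotate (suc (toℕ i)) xs ≡ rest ∷ʳ lookup xs i
rotate-suc xs i =
  cong (_++ take (toℕ i) xs) (drop-lookup xs i) ,
  trans (cong (drop (suc (toℕ i)) xs ++_) (take-suc xs i))
        (sym (++-assoc (drop (suc (toℕ i)) xs) (take (toℕ i) xs) _))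

last-∷ʳ : (xs : List A) (x : A) → last (xs ∷ʳ x) ≡ just x
last-∷ʳ []           x = refl
last-∷ʳ (_ ∷ [])     x = refl
last-∷ʳ (_ ∷ y ∷ xs) x = last-∷ʳ (y ∷ xs) x

-- For the trajectory string, `CyclicFactor T w w′` unfolds to `ET w′ w`.
CyclicFactor : {A : Set a} → List A → A → A → Set a
CyclicFactor xs u v = Any (Infix _≡_ (u ∷ v ∷ [])) (rotations xs)

Ends : {A : Set a} → Rel A ℓ → List A → Set (a ⊔ ℓ)
Ends R row = ∃₂ λ u v → last row ≡ just u × head row ≡ just v × R u v

-- Moving the first symbol of a rotation to its end yields the next rotation, in which the old
-- last symbol immediately precedes the old first one.
rotate-ends : (xs : List A) → 1 < length xs → (i : Fin (length xs)) →
  Ends (CyclicFactor xs) (rotate (toℕ i) xs)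
rotate-ends xs 1<n i with rotate-suc xs i
... | eq , eq′ with drop (suc (toℕ i)) xs ++ take (toℕ i) xs
...   | rest with initLast rest
-- An empty `rest` would leave a rotation of one symbol, whose last and first symbols are the same
-- occurrence.
...     | []        = contradiction
  (subst (1 <_) (trans (sym (length-rotate (toℕ i) xs)) (cong length eq)) 1<n) (ℕ.<-irrefl refl)
...     | pre ∷ʳ′ u = u , lookup xs i ,
  trans (cong last eq) (last-∷ʳ (lookup xs i ∷ pre) u) ,
  cong head eq ,
  lose (rotate∈rotations xs (ℕ.<⇒≤ 1<n) (toℕ<n i))
       (subst (Infix _≡_ _) (sym (trans eq′ (++-assoc pre _ _)))
              (pre ++ⁱ here (refl ∷ refl ∷ [])))

rotations-ends : (xs : List A) → 1 < length xs → All (Ends (CyclicFactor xs)) (rotations xs)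
rotations-ends xs 1<n = All.map⁺ (All.applyUpTo⁺₁ _ (length xs) λ i<n →
  subst (λ k → Ends (CyclicFactor xs) (rotate k xs)) (toℕ-fromℕ< i<n)
        (rotate-ends xs 1<n (fromℕ< i<n)))

-- `Ends` makes every row nonempty, so neither `mapMaybe` drops a row and the two columns stay
-- aligned.
ends⇒pointwise : {R : Rel A ℓ} {rows : List (List A)} → All (Ends R) rows →
  Pointwise R (mapMaybe last rows) (mapMaybe head rows)
ends⇒pointwise [] = []
ends⇒pointwise ((u , v , last≡u , head≡v , Ruv) ∷ ends)
  rewrite last≡u | head≡v = Ruv ∷ ends⇒pointwise ends

-- The tails are an arbitrary `t` because `take (suc i) (x ∷ xs)` is not `take i xs`, so the
-- induction would not go through for `take` itself.
heads-applyUpTo : (xs : List A) (t : ℕ → List A) →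
  mapMaybe head (applyUpTo (λ i → drop i xs ++ t i) (length xs)) ≡ xs
heads-applyUpTo []       t = refl
heads-applyUpTo (x ∷ xs) t = cong (x ∷_) (heads-applyUpTo xs (t ∘ suc))

heads-rotations : (xs : List A) → mapMaybe head (rotations xs) ≡ xs
heads-rotations xs = trans (cong (mapMaybe head) (map-upTo _ (length xs)))
                           (heads-applyUpTo xs (λ i → take i xs))

module _ (O : StrictTotalOrder 0ℓ 0ℓ 0ℓ) where
  open Counting O using (InBlock; sorted-inBlock; inBlock-↭) renaming (_≤_ to _≼_)
  open DecTotalOrder (Lex.≤-decTotalOrder O) using (totalOrder) renaming (_≤_ to _≤ₗₑₓ_)
  open Sort (Lex.≤-decTotalOrder O) using (sort; sort-↭; sort-↗)

  -- Lexicographic order looks past the first symbols only when they are equal.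
  heads-sorted : ∀ {rows} → AllPairs _≤ₗₑₓ_ rows → AllPairs _≼_ (mapMaybe head rows)
  heads-sorted []                           = []
  heads-sorted {[] ∷ _}       (_ ∷ rows↗)   = heads-sorted rows↗
  heads-sorted {(x ∷ xs) ∷ _} (xs≤ ∷ rows↗) =
    All.mapMaybe⁺ (All.map⁺ (All.map head-≼ xs≤)) ∷ heads-sorted rows↗
    where
    head-≼ : ∀ {ys} → (x ∷ xs) ≤ₗₑₓ ys → Maybe.All (x ≼_) (head ys)
    head-≼ (this x<y)   = Maybe.just (inj₁ x<y)
    head-≼ (next x≈y _) = Maybe.just (inj₂ x≈y)

  -- The first column of the sorted rotations is a sorted permutation of `xs`. The separate `k` lets
  -- a position in `T-bwt` be used after a cast to this column.
  sortedHead-inBlock : ∀ xs (i : Fin (length (mapMaybe head (sort (rotations xs))))) {k} →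
    toℕ i ≡ k → InBlock xs k (lookup (mapMaybe head (sort (rotations xs))) i)
  sortedHead-inBlock xs i refl = inBlock-↭
    (↭-trans (mapMaybe-↭ head (sort-↭ (rotations xs))) (↭-reflexive (heads-rotations xs)))
    (sorted-inBlock (heads-sorted (Sorted⇒AllPairs totalOrder (sort-↗ (rotations xs)))) i)

  -- `Ends` concerns each row separately, so it survives the reordering by `sort`.
  bwt-ends : ∀ xs → 1 < length xs →
    Pointwise (CyclicFactor xs) (mapMaybe last (sort (rotations xs)))
                                (mapMaybe head (sort (rotations xs)))
  bwt-ends xs 1<n = ends⇒pointwise
    (All-resp-↭ (↭-sym (sort-↭ (rotations xs))) (rotations-ends xs 1<n))

module _ (G : RoadNetwork) (Ts : List⁺ (NCT G)) where
  open Trajectories G Ts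
  open Counting symbolOrder using (InBlock; inBlock-unique)

  0<∣encode∣ : ∀ t → 0 < length (encode t)
  0<∣encode∣ t = length-++-≤ʳ ($ ∷ []) {map seg (reverse (toList (NCT.segments t)))}

  0<∣concatMap-encode∣ : ∀ ts → 0 < length (concatMap encode (toList ts))
  0<∣concatMap-encode∣ (t ∷ ts) = ℕ.≤-trans (0<∣encode∣ t) (length-++-≤ˡ (encode t))

  -- At least one trajectory contributes a `$`, and the final `#` is a second symbol.
  1<∣T∣ : 1 < length T
  1<∣T∣ = subst (1 <_) (sym (length-++ (concatMap encode (toList Ts))))
                (ℕ.+-monoˡ-≤ 1 (0<∣concatMap-encode∣ Ts))

  -- The head of the sorted row at `i` has `i` in its block; blocks being disjoint, it is `w′`, and
  -- the last symbol of the same row precedes it cyclically.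
  T-bwt∈N-out : ∀ {w′} (i : Fin (length T-bwt)) → InBlock T (toℕ i) w′ → lookup T-bwt i ∈ N-out w′
  T-bwt∈N-out i inBlock = subst (λ v → ET v (lookup T-bwt i))
    (inBlock-unique T (sortedHead-inBlock symbolOrder T _ (toℕ-cast _ i)) inBlock)
    (Pointwise.lookup⁺ (bwt-ends symbolOrder T 1<∣T∣) i)

  module _ (r : RML) where
    open RML r

    label-agrees : ∀ {w w′} → w ∈ N-out w′ → ∀ i → InBlock T (toℕ i) w′ →
      w ≡ lookup T-bwt i ⇔ φ w w′ ≡ φ (lookup T-bwt i) (proj₁ (context i))
    label-agrees {w} {w′} w∈N i inBlock
      -- `context i` carries some symbol whose block contains `i`; uniqueness turns it into `w′`, so
      -- both labels are taken in the same context.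
      rewrite inBlock-unique T (proj₁ (proj₂ (context i))) inBlock =
      mk⇔ (cong (λ v → φ v w′)) (one-to-one w∈N (T-bwt∈N-out i inBlock))

-- In its use `m` and `r` are the ranks at `j`, `q` and `s` those at `C w′`, so that `+ q - + s` is
-- `Z`.
m+q≡r+s⇒m≡r-[q-s] : ∀ m q r s → m + q ≡ r + s → + m ≡ + r - (+ q - + s)
m+q≡r+s⇒m≡r-[q-s] m q r s eq = begin
  + m                     ≡⟨ add-sub (+ m) (+ q) ⟩
  -- `+ m ℤ.+ + q` computes to `+ (m + q)`, so `eq` applies directly.
  (+ m ℤ.+ + q) - + q     ≡⟨ cong (λ n → + n - + q) eq ⟩
  (+ r ℤ.+ + s) - + q     ≡⟨ regroup (+ r) (+ q) (+ s) ⟩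
  + r - (+ q - + s)       ∎
  where
  open ≡-Reasoning
  add-sub : ∀ i k → i ≡ (i ℤ.+ k) - k
  add-sub = solve-∀
  regroup : ∀ i k l → (i ℤ.+ l) - k ≡ i - (k - l)
  regroup = solve-∀

theorem2 : (G : RoadNetwork) (Ts : List⁺ (NCT G)) →
    let open Trajectories G Ts in
    (r : RML) → let open RML r in
    (w w′ : Symbol) (j : ℕ) →
    w ∈ N-out w′ → C w′ ≤ j → j ≤ C⁺ w′ →
    let η = φ w w′
        Z = + rank ℕ._≟_ η (labeledBWT r) (C w′) - + rank _≟_ w T-bwt (C w′)
    in + rank _≟_ w T-bwt j ≡ + rank ℕ._≟_ η (labeledBWT r) j - Z
theorem2 G Ts r w w′ j w∈N C≤j j≤C⁺ =
  m+q≡r+s⇒m≡r-[q-s]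
    (rank _≟_ w T-bwt j) (rank ℕ._≟_ η (labeledBWT r) (C w′))
    (rank ℕ._≟_ η (labeledBWT r) j) (rank _≟_ w T-bwt (C w′))
    (rank-increment-cong _≟_ ℕ._≟_ T-bwt _ C≤j λ i C≤i i<j →
      -- Ranks up to `j` read only positions below `j`, so even `j` equal to `C⁺ w′` keeps every `i`
      -- inside the block.
      label-agrees G Ts r w∈N i (C≤i , ℕ.<-≤-trans i<j j≤C⁺))
  where
  open Trajectories G Ts
  η = RML.φ r w w′
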